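{- Let $a,b\ge1$ be integers. The cube polynomials of the Horadam cubes satisfy, for all $n\ge2$, $$C(\Pi^{a,b}_n,x)=(a+(a-1)x)\,C(\Pi^{a,b}_{n-1},x)+(b+bx)\,C(\Pi^{a,b}_{n-2},x),$$ with initial conditions $C(\Pi^{a,b}_0,x)=1$ and $C(\Pi^{a,b}_1,x)=a+(a-1)x$.
   Context: For integers $a,b\ge1$ and $n\ge 0$, $\mathcal S^{a,b}_n$ is the set of all strings of length $n$ over the alphabet $\{0,1,\dots,a+b-1\}$ in which every letter from $\{a,\dots,a+b-1\}$ appears only immediately after a letter $0$; $\mathcal S^{a,b}_0$ contains only the empty string. The Horadam cube $\Pi^{a,b}_n$ is the simple graph with vertex set $\mathcal S^{a,b}_n$ in which $x_1\cdots x_n$ and $y_1\cdots y_n$ are adjacent if and only if $\sum_{i=1}^n|x_i-y_i|=1$. For a graph $G$, $c_k(G)$ is the number of induced subgraphs of $G$ isomorphic to the $k$-dimensional hypercube $Q_k$, and the cube polynomial is $C(G,x)=\sum_{k\ge0}c_k(G)x^k$. -}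

module Defs where

open import Data.Bool using (Bool; _xor_)
open import Data.Fin as Fin using (Fin; zero; suc; toℕ)
import Data.Fin.Properties as Fin
open import Data.Fin.Subset using (Subset; _∈_)
open import Data.Fin.Subset.Properties using (_∈?_)
open import Data.Integer using (ℤ; +_; 0ℤ; 1ℤ) renaming (_+_ to _+ℤ_; _*_ to _*ℤ_)
open import Data.Irrelevant using ([_])
open import Data.List using (List; []; _∷_; map; applyUpTo)
open import Data.Nat using (ℕ; zero; suc; _+_; _*_; _^_; _≤_; _<_; z≤n; s≤s; ∣_-_∣)
import Data.Nat.Properties as ℕ
open import Data.Product using (∃; _×_; _,_; proj₁; proj₂)
open import Data.Product.Function.NonDependent.Propositional using (_×-↔_)
open import Data.Refinement using (Refinement; Refinement-syntax; value; proof; value-injective)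
import Data.Refinement as Refinement
open import Data.Vec as Vec using (Vec; []; _∷_; lookup; tabulate; zipWith; countᵇ)
import Data.Vec.Properties as Vec
open import Function using (_∘_; id; _↔_; _⇔_; mk⇔; mk↔ₛ′; Inverse; Injection; Equivalence)
open import Function.Construct.Composition using (_↔-∘_)
open import Function.Construct.Identity using (↔-id)
open import Function.Construct.Symmetry using (↔-sym)
open import Function.Properties.Inverse using (Inverse⇒Injection)
open import Relation.Binary using (Decidable; DecidableEquality; Symmetric; Irreflexive)
open import Relation.Binary.PropositionalEquality
open import Relation.Nullary using (Dec; yes; no; ¬_; contradiction; contradiction-irr)
open import Relation.Nullary.Decidable using (map′; _×-dec_; _→-dec_)
import Relation.Unary as Unary

infix 4 _≅_ _≅?_ _≋_
infixl 6 _+ₚ_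
infixl 7 _*ₚ_

------------------------------------------------------------------------
-- Finite types

record Finite (A : Set) : Set where
  field
    card : ℕ
    enum : A ↔ Fin card

  index : A → Fin card
  index = Inverse.to enum

  element : Fin card → A
  element = Inverse.from enum

  index-element : ∀ i → index (element i) ≡ i
  index-element = Inverse.strictlyInverseˡ enum

  element-index : ∀ x → element (index x) ≡ x
  element-index = Inverse.strictlyInverseʳ enum

  index-injective : ∀ {x y} → index x ≡ index y → x ≡ y
  index-injective {x} {y} eq =
    trans (sym (element-index x)) (trans (cong element eq) (element-index y))

  _≟_ : DecidableEquality A
  x ≟ y = map′ index-injective (cong index) (index x Fin.≟ index y)

  any? : {P : A → Set} → Unary.Decidable P → Dec (∃ P)
  any? {P} P? = map′
    (λ (i , p) → element i , p)
    (λ (x , p) → index x , subst P (sym (element-index x)) p)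
    (Fin.any? (P? ∘ element))

  all? : {P : A → Set} → Unary.Decidable P → Dec (∀ x → P x)
  all? {P} P? = map′
    (λ h x → subst P (element-index x) (h (index x)))
    (λ h i → h (element i))
    (Fin.all? (P? ∘ element))

open Finite using (card)

finite-via : {A B : Set} → A ↔ B → Finite B → Finite A
finite-via A↔B finB = record { card = card finB ; enum = Finite.enum finB ↔-∘ A↔B }

Fin-finite : ∀ n → Finite (Fin n)
Fin-finite n = record { card = n ; enum = ↔-id _ }

Bool-finite : Finite Bool
Bool-finite = record { card = 2 ; enum = ↔-sym Fin.2↔Bool }

×-finite : {A B : Set} → Finite A → Finite B → Finite (A × B)
×-finite finA finB = record
  { card = card finA * card finB
  ; enum = ↔-sym Fin.*↔× ↔-∘ (Finite.enum finA ×-↔ Finite.enum finB)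
  }

Vec-finite : {A : Set} → Finite A → ∀ n → Finite (Vec A n)
Vec-finite finA zero    = record
  { card = 1
  ; enum = mk↔ₛ′ (λ _ → zero) (λ _ → []) (λ { zero → refl }) (λ { [] → refl })
  }
Vec-finite finA (suc n) = finite-via
  (mk↔ₛ′ (λ { (x ∷ xs) → x , xs }) (λ (x , xs) → x ∷ xs)
         (λ _ → refl) (λ { (_ ∷ _) → refl }))
  (×-finite finA (Vec-finite finA n))

card-Vec : {A : Set} (finA : Finite A) → ∀ n → card (Vec-finite finA n) ≡ card finA ^ n
card-Vec finA zero    = refl
card-Vec finA (suc n) = cong (card finA *_) (card-Vec finA n)

private
  Fin-filter : ∀ {n} {P : Fin n → Set} → Unary.Decidable P → Finite [ i ∈ Fin n ∣ P i ]
  Fin-filter {zero}      P? = record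
    { card = 0
    ; enum = mk↔ₛ′ (λ { (() Refinement., _) }) (λ ()) (λ ()) (λ { (() Refinement., _) })
    }
  Fin-filter {suc n} {P} P? with P? zero | Fin-filter (P? ∘ suc)
  ... | yes p0 | rec = record { card = suc (card rec) ; enum = mk↔ₛ′ to from to-from from-to }
    where
    open Finite rec using (index; element; index-element; element-index)

    to : [ i ∈ Fin (suc n) ∣ P i ] → Fin (suc (card rec))
    to (zero  Refinement., _) = zero
    to (suc i Refinement., p) = suc (index (i Refinement., p))

    from : Fin (suc (card rec)) → [ i ∈ Fin (suc n) ∣ P i ]
    from zero    = zero Refinement., [ p0 ]
    from (suc j) = suc (value (element j)) Refinement., proof (element j)

    to-from : ∀ j → to (from j) ≡ j
    to-from zero    = refl
    to-from (suc j) = cong suc (index-element j)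

    from-to : ∀ x → from (to x) ≡ x
    from-to (zero  Refinement., _) = refl
    from-to (suc i Refinement., p) = value-injective (cong (suc ∘ value) (element-index (i Refinement., p)))
  ... | no ¬p0 | rec = record { card = card rec ; enum = mk↔ₛ′ to from to-from from-to }
    where
    open Finite rec using (index; element; index-element; element-index)

    to : [ i ∈ Fin (suc n) ∣ P i ] → Fin (card rec)
    to (zero  Refinement., [ p ]) = contradiction-irr p ¬p0
    to (suc i Refinement., p) = index (i Refinement., p)

    from : Fin (card rec) → [ i ∈ Fin (suc n) ∣ P i ]
    from j = suc (value (element j)) Refinement., proof (element j)

    to-from : ∀ j → to (from j) ≡ j
    to-from j = index-element j

    from-to : ∀ x → from (to x) ≡ x
    from-to (zero  Refinement., [ p ]) = contradiction-irr p ¬p0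
    from-to (suc i Refinement., p) = value-injective (cong (suc ∘ value) (element-index (i Refinement., p)))

Refinement-finite : {A : Set} {P : A → Set} → Finite A → Unary.Decidable P →
                    Finite [ x ∈ A ∣ P x ]
Refinement-finite {A} {P} finA P? = finite-via
  (mk↔ₛ′
    (λ { (x Refinement., [ p ]) → index x Refinement., [ subst P (sym (element-index x)) p ] })
    (λ { (i Refinement., p) → element i Refinement., p })
    (λ { (i Refinement., _) → value-injective (index-element i) })
    (λ { (x Refinement., _) → value-injective (element-index x) }))
  (Fin-filter (P? ∘ element))
  where open Finite finA using (index; element; index-element; element-index)

------------------------------------------------------------------------
-- Finite simple graphs

record Graph : Set₁ where
  infix 4 _~_ _~?_
  field
    Vertex   : Set
    finite   : Finite Vertex
    _~_      : Vertex → Vertex → Set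
    _~?_     : Decidable _~_
    ~-sym    : Symmetric _~_
    ~-irrefl : Irreflexive _≡_ _~_

  order : ℕ
  order = card finite

open Graph using (Vertex; finite; order)

record _≅_ (G H : Graph) : Set where
  private
    module G = Graph G
    module H = Graph H
  field
    bijection : G.Vertex ↔ H.Vertex
  open Inverse bijection using (to)
  field
    adjacency : ∀ u v → (u G.~ v) ⇔ (to u H.~ to v)

_≅?_ : Decidable _≅_
G ≅? H = map′ fromTables toTables (Finite.any? finTables isIso?)
  where
  module G where
    open Graph G public
    open Finite (Graph.finite G) public
  module H where
    open Graph H public
    open Finite (Graph.finite H) public

  -- a pair of maps G → H and H → G, given by their tables of values
  Tables : Set
  Tables = Vec H.Vertex G.order × Vec G.Vertex H.order

  finTables : Finite Tables
  finTables = ×-finite (Vec-finite H.finite _) (Vec-finite G.finite _)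

  module _ (t : Tables) where
    fwd : G.Vertex → H.Vertex
    fwd u = lookup (proj₁ t) (G.index u)

    bwd : H.Vertex → G.Vertex
    bwd v = lookup (proj₂ t) (H.index v)

    IsIso : Set
    IsIso = (∀ v → fwd (bwd v) ≡ v)
          × (∀ u → bwd (fwd u) ≡ u)
          × (∀ u v → (u G.~ v → fwd u H.~ fwd v) × (fwd u H.~ fwd v → u G.~ v))

    isIso? : Dec IsIso
    isIso? = H.all? (λ v → fwd (bwd v) H.≟ v)
       ×-dec G.all? (λ u → bwd (fwd u) G.≟ u)
       ×-dec G.all? (λ u → G.all? λ v →
               ((u G.~? v) →-dec (fwd u H.~? fwd v))
         ×-dec ((fwd u H.~? fwd v) →-dec (u G.~? v)))

  fromTables : ∃ IsIso → G ≅ H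
  fromTables (t , invˡ , invʳ , adj) = record
    { bijection = mk↔ₛ′ (fwd t) (bwd t) invˡ invʳ
    ; adjacency = λ u v → mk⇔ (proj₁ (adj u v)) (proj₂ (adj u v))
    }

  toTables : G ≅ H → ∃ IsIso
  toTables iso = t , invˡ , invʳ , adj
    where
    open _≅_ iso
    open Inverse bijection using (to; from; strictlyInverseˡ; strictlyInverseʳ)

    t : Tables
    t = tabulate (to ∘ G.element) , tabulate (from ∘ H.element)

    fwd≗to : ∀ u → fwd t u ≡ to u
    fwd≗to u = trans (Vec.lookup∘tabulate _ (G.index u)) (cong to (G.element-index u))

    bwd≗from : ∀ v → bwd t v ≡ from v
    bwd≗from v = trans (Vec.lookup∘tabulate _ (H.index v)) (cong from (H.element-index v))

    invˡ : ∀ v → fwd t (bwd t v) ≡ v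
    invˡ v = trans (fwd≗to _) (trans (cong to (bwd≗from v)) (strictlyInverseˡ v))

    invʳ : ∀ u → bwd t (fwd t u) ≡ u
    invʳ u = trans (bwd≗from _) (trans (cong from (fwd≗to u)) (strictlyInverseʳ u))

    adj : ∀ u v → (u G.~ v → fwd t u H.~ fwd t v) × (fwd t u H.~ fwd t v → u G.~ v)
    adj u v rewrite fwd≗to u | fwd≗to v =
      Equivalence.to (adjacency u v) , Equivalence.from (adjacency u v)

induced : (G : Graph) → Subset (order G) → Graph
induced G S = record
  { Vertex   = [ v ∈ G.Vertex ∣ G.index v ∈ S ]
  ; finite   = Refinement-finite G.finite (λ v → G.index v ∈? S)
  ; _~_      = λ u v → value u G.~ value v
  ; _~?_     = λ u v → value u G.~? value v
  ; ~-sym    = G.~-sym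
  ; ~-irrefl = λ { refl → G.~-irrefl refl }
  }
  where
  module G where
    open Graph G public
    open Finite (Graph.finite G) public

------------------------------------------------------------------------
-- Hypercubes

hamming : ∀ {k} → Vec Bool k → Vec Bool k → ℕ
hamming x y = countᵇ id (zipWith _xor_ x y)

private
  xor-comm : ∀ p q → p xor q ≡ q xor p
  xor-comm Bool.false Bool.false = refl
  xor-comm Bool.false Bool.true  = refl
  xor-comm Bool.true  Bool.false = refl
  xor-comm Bool.true  Bool.true  = refl

  hamming-refl : ∀ {k} (x : Vec Bool k) → hamming x x ≡ 0
  hamming-refl []               = refl
  hamming-refl (Bool.false ∷ x) = hamming-refl x
  hamming-refl (Bool.true  ∷ x) = hamming-refl x

Q : ℕ → Graph
Q k = record
  { Vertex   = Vec Bool k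
  ; finite   = Vec-finite Bool-finite k
  ; _~_      = λ x y → hamming x y ≡ 1
  ; _~?_     = λ x y → hamming x y ℕ.≟ 1
  ; ~-sym    = λ {x} {y} → trans (cong (countᵇ id) (Vec.zipWith-comm xor-comm y x))
  ; ~-irrefl = λ { {x} refl eq → contradiction (trans (sym (hamming-refl x)) eq) λ () }
  }

------------------------------------------------------------------------
-- Horadam cubes

-- Every letter from {a, …, a+b-1} is immediately preceded by a letter 0;
-- in particular the first letter is less than a.
Admissible : ∀ a b {n} → Vec (Fin (a + b)) n → Set
Admissible a b x =
  ∀ i → a ≤ toℕ (lookup x i) → ∃ λ j → toℕ i ≡ suc (toℕ j) × toℕ (lookup x j) ≡ 0

admissible? : ∀ a b {n} → Unary.Decidable (Admissible a b {n})
admissible? a b x = Fin.all? λ i →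
  (a ℕ.≤? toℕ (lookup x i)) →-dec
  Fin.any? (λ j → (toℕ i ℕ.≟ suc (toℕ j)) ×-dec (toℕ (lookup x j) ℕ.≟ 0))

𝓢 : ℕ → ℕ → ℕ → Set
𝓢 a b n = [ x ∈ Vec (Fin (a + b)) n ∣ Admissible a b x ]

distance : ∀ {m n} → Vec (Fin m) n → Vec (Fin m) n → ℕ
distance x y = Vec.sum (zipWith (λ i j → ∣ toℕ i - toℕ j ∣) x y)

private
  distance-refl : ∀ {m n} (x : Vec (Fin m) n) → distance x x ≡ 0
  distance-refl []      = refl
  distance-refl (i ∷ x) = cong₂ _+_ (ℕ.∣n-n∣≡0 (toℕ i)) (distance-refl x)

Π : ℕ → ℕ → ℕ → Graph
Π a b n = record
  { Vertex   = 𝓢 a b n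
  ; finite   = Refinement-finite (Vec-finite (Fin-finite (a + b)) n) (admissible? a b)
  ; _~_      = λ x y → distance (value x) (value y) ≡ 1
  ; _~?_     = λ x y → distance (value x) (value y) ℕ.≟ 1
  ; ~-sym    = λ {x} {y} → trans (cong Vec.sum
                 (Vec.zipWith-comm (λ i j → ℕ.∣-∣-comm (toℕ i) (toℕ j)) (value y) (value x)))
  ; ~-irrefl = λ { {x} refl eq → contradiction (trans (sym (distance-refl (value x))) eq) λ () }
  }

------------------------------------------------------------------------
-- Polynomials over ℤ

-- Coefficients in increasing degree; trailing zeros are allowed, so
-- equality of polynomials is _≋_.
Poly : Set
Poly = List ℤ

coeff : Poly → ℕ → ℤ
coeff []      _       = 0ℤ
coeff (c ∷ p) zero    = c
coeff (c ∷ p) (suc k) = coeff p k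

_≋_ : Poly → Poly → Set
p ≋ q = ∀ k → coeff p k ≡ coeff q k

const : ℤ → Poly
const c = c ∷ []

X : Poly
X = 0ℤ ∷ 1ℤ ∷ []

_+ₚ_ : Poly → Poly → Poly
[]      +ₚ q       = q
(c ∷ p) +ₚ []      = c ∷ p
(c ∷ p) +ₚ (d ∷ q) = (c +ℤ d) ∷ (p +ₚ q)

_*ₚ_ : Poly → Poly → Poly
[]      *ₚ q = []
(c ∷ p) *ₚ q = map (c *ℤ_) q +ₚ (0ℤ ∷ p *ₚ q)

------------------------------------------------------------------------
-- Cube polynomials

-- An induced subgraph is identified with its vertex set.
cubes : (G : Graph) (k : ℕ) → Finite [ S ∈ Subset (order G) ∣ induced G S ≅ Q k ]
cubes G k = Refinement-finite (Vec-finite Bool-finite (order G)) (λ S → induced G S ≅? Q k)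

c : ℕ → Graph → ℕ
c k G = card (cubes G k)

-- The sum of c k G xᵏ over all k may be cut off at the order of G; see coeff-C.
C : Graph → Poly
C G = applyUpTo (λ k → + c k G) (order G)

private
  k<2^k : ∀ k → k < 2 ^ k
  k<2^k zero    = s≤s z≤n
  k<2^k (suc k) = ℕ.≤-trans (s≤s (k<2^k k))
    (ℕ.≤-trans (ℕ.+-monoˡ-≤ (2 ^ k) (ℕ.≤-trans (s≤s z≤n) (k<2^k k)))
      (ℕ.≤-reflexive (cong (_+_ (2 ^ k)) (sym (ℕ.+-identityʳ (2 ^ k))))))

  cube⇒<order : ∀ G k (S : Subset (order G)) → induced G S ≅ Q k → k < order G
  cube⇒<order G k S iso = ℕ.<-≤-trans (k<2^k k)
    (ℕ.≤-trans (ℕ.≤-reflexive (sym (card-Vec Bool-finite k))) (Fin.injective⇒≤ f-injective))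
    where
    module K = Finite (finite (Q k))
    module G = Finite (finite G)
    open Inverse (_≅_.bijection iso) using (from)

    inverse-injective : {A B : Set} (e : A ↔ B) → ∀ {x y} → Inverse.to e x ≡ Inverse.to e y → x ≡ y
    inverse-injective e = Injection.injective (Inverse⇒Injection e)

    f : Fin K.card → Fin G.card
    f i = G.index (value (from (K.element i)))

    f-injective : ∀ {i j} → f i ≡ f j → i ≡ j
    f-injective eq = inverse-injective (↔-sym K.enum)
      (inverse-injective (↔-sym (_≅_.bijection iso))
        (value-injective (G.index-injective eq)))

  coeff-applyUpTo-< : ∀ (f : ℕ → ℤ) {n k} → k < n → coeff (applyUpTo f n) k ≡ f k
  coeff-applyUpTo-< f {suc n} {zero}  _         = refl
  coeff-applyUpTo-< f {suc n} {suc k} (s≤s k<n) = coeff-applyUpTo-< (f ∘ suc) k<n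

  coeff-applyUpTo-≥ : ∀ (f : ℕ → ℤ) {n k} → n ≤ k → coeff (applyUpTo f n) k ≡ 0ℤ
  coeff-applyUpTo-≥ f {zero}          _         = refl
  coeff-applyUpTo-≥ f {suc n} {suc k} (s≤s n≤k) = coeff-applyUpTo-≥ (f ∘ suc) n≤k

  card≡0 : {A : Set} (finA : Finite A) → ¬ A → card finA ≡ 0
  card≡0 record { card = zero }             ¬a = refl
  card≡0 record { card = suc _ ; enum = e } ¬a = contradiction (Inverse.from e zero) ¬a

  c≡0 : ∀ k G → ¬ (k < order G) → c k G ≡ 0
  c≡0 k G k≮n = card≡0 (cubes G k)
    λ { (S Refinement., [ iso ]) → contradiction-irr (cube⇒<order G k S iso) k≮n }

coeff-C : ∀ G k → coeff (C G) k ≡ + c k G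
coeff-C G k = go (k ℕ.<? order G)
  where
  go : Dec (k < order G) → coeff (C G) k ≡ + c k G
  go (yes k<n) = coeff-applyUpTo-< (λ k → + c k G) k<n
  go (no  k≮n) = trans (coeff-applyUpTo-≥ (λ k → + c k G) (ℕ.≮⇒≥ k≮n))
                       (cong +_ (sym (c≡0 k G k≮n)))

{-# OPTIONS --safe #-}
module Submission where

open import Data.Bool using (Bool; true; false; not)
open import Data.Bool.Properties using (¬-not; not-¬) renaming (_≟_ to _≟ᵇ_)
open import Data.Fin using (Fin; zero; suc; toℕ; fromℕ<)
import Data.Fin.Permutation as Fin
import Data.Fin.Properties as Fin
open import Data.Fin.Subset using (Subset; _∈_)
open import Data.Fin.Subset.Properties using (_∈?_; ⊆-antisym)
open import Data.Integer as ℤ using (+_; _-_; 0ℤ)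
import Data.Integer.Properties as ℤ
open import Data.Integer.Tactic.RingSolver using (solve-∀)
open import Data.Irrelevant using ([_])
open import Data.List as List using ([]; _∷_)
open import Data.Nat using (ℕ; zero; suc; 2+; _+_; _*_; _∸_; ∣_-_∣; _≤_; _<_; z≤n; s≤s)
import Data.Nat.Properties as ℕ
open import Data.Product using (∃; _×_; _,_; proj₁; proj₂)
open import Data.Refinement as Refinement using (Refinement-syntax; value; proof; value-injective)
open import Data.Sum as Sum using (_⊎_; inj₁; inj₂)
open import Data.Sum.Function.Propositional using (_⊎-↔_)
open import Data.Vec as Vec using (Vec; []; _∷_; lookup; replicate; tabulate; zipWith)
import Data.Vec.Properties as Vec
open import Function using (_∘_; case_of_; _↔_; mk↔ₛ′; _⇔_; mk⇔; Equivalence; Injection; Inverse)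
open import Function.Construct.Composition using (_↔-∘_)
open import Function.Construct.Symmetry using (↔-sym)
open import Function.Properties.Inverse using (Inverse⇒Injection)
open import Relation.Binary.PropositionalEquality
open import Relation.Nullary using (¬_; Dec; yes; no; does; contradiction; recompute)
open import Relation.Nullary.Decidable using (map′; dec-true)
open import Relation.Unary using (Decidable)
open import Defs

-- Regard Π a b n as a subgraph of the grid ℕⁿ.  Opposite edges of a 4-cycle in the grid
-- are parallel, so the two facets of an embedded hypercube are translates of each other
-- by a unit vector; hence the vertex sets of induced hypercubes are exactly the boxes
-- (products of points and edges) all of whose vertices are admissible.  Such a box
-- starts either with one of a points or a - 1 edges, followed by a box of length n - 1,
-- or with the point 0 and one of the b points and b edges whose upper end is at least a,
-- followed by a box of length n - 2.

open Equivalence using (to; from)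
open Finite using (card)

private variable
  i k n : ℕ
  x y x′ y′ : Vec ℕ n
  s : Bool
  j : Fin n
  d d′ e e′ : Bool × Fin n

-- Geometry of the grid

dist : Vec ℕ n → Vec ℕ n → ℕ
dist x y = Vec.sum (zipWith ∣_-_∣ x y)

-- The sign and the coordinate are an index of the type, so that edges of the grid are parallel
-- exactly when their indices agree up to sign.
data Step : Bool × Fin n → Vec ℕ n → Vec ℕ n → Set where
  up    : Step (true , zero) (i ∷ x) (suc i ∷ x)
  down  : Step (false , zero) (suc i ∷ x) (i ∷ x)
  there : Step (s , j) x y → Step (s , suc j) (i ∷ x) (i ∷ y)

dist≡0⇒≡ : (x y : Vec ℕ n) → dist x y ≡ 0 → x ≡ y
dist≡0⇒≡ []      []      _  = refl
dist≡0⇒≡ (i ∷ x) (j ∷ y) eq = cong₂ _∷_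
  (ℕ.∣m-n∣≡0⇒m≡n (ℕ.m+n≡0⇒m≡0 _ eq))
  (dist≡0⇒≡ x y (ℕ.m+n≡0⇒n≡0 ∣ i - j ∣ eq))

dist≡1⇒step : (x y : Vec ℕ n) → dist x y ≡ 1 → ∃ λ d → Step d x y
dist≡1⇒step [] [] ()
dist≡1⇒step (zero  ∷ x) (zero  ∷ y) eq =
  let _ , p = dist≡1⇒step x y eq in _ , there p
dist≡1⇒step (zero  ∷ x) (suc zero ∷ y) eq
  with refl ← dist≡0⇒≡ x y (ℕ.suc-injective eq) = _ , up
dist≡1⇒step (suc zero ∷ x) (zero ∷ y) eq
  with refl ← dist≡0⇒≡ x y (ℕ.suc-injective eq) = _ , down
dist≡1⇒step (suc i ∷ x) (suc j ∷ y) eq with dist≡1⇒step (i ∷ x) (j ∷ y) eq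
... | _ , up      = _ , up
... | _ , down    = _ , down
... | _ , there p = _ , there p

step-functional : Step d x y → Step d x y′ → y ≡ y′
step-functional up        up        = refl
step-functional down      down      = refl
step-functional (there p) (there q) = cong (_ ∷_) (step-functional p q)

step-reverse : Step (s , j) x y → Step (not s , j) y x
step-reverse up        = down
step-reverse down      = up
step-reverse (there p) = there (step-reverse p)

step-unique : Step d x y → Step e x y → d ≡ e
step-unique up        up        = refl
step-unique down      down      = refl
step-unique (there p) (there q) with refl ← step-unique p q = refl

-- Read as signed unit vectors, the steps round the square satisfy d + e′ = e + d′. As `x ≢ y′`,
-- these sums are nonzero, and a nonzero sum of two signed unit vectors determines its summands up
-- to order. As `y ≢ x′`, d differs from e, which leaves d = d′.
square-parallel : Step d x x′ → Step d′ y y′ → Step e x y → Step e′ x′ y′ →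
                  x ≢ y′ → y ≢ x′ → d ≡ d′
square-parallel up        p         up        r  x≢y′ y≢x′ = contradiction refl y≢x′
square-parallel up        up        down      r  x≢y′ y≢x′ = contradiction refl x≢y′
square-parallel up        up        (there q) r  x≢y′ y≢x′ = refl
square-parallel up        (there p) (there q) down x≢y′ y≢x′ = contradiction refl x≢y′
square-parallel down      p         down      r  x≢y′ y≢x′ = contradiction refl y≢x′
square-parallel down      down      up        r  x≢y′ y≢x′ = contradiction refl x≢y′
square-parallel down      down      (there q) r  x≢y′ y≢x′ = refl
square-parallel down      (there p) (there q) up x≢y′ y≢x′ = contradiction refl x≢y′
square-parallel (there o) down      up        (there r) x≢y′ y≢x′ = contradiction refl x≢y′
square-parallel (there o) up        down      (there r) x≢y′ y≢x′ = contradiction refl x≢y′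
square-parallel (there o) (there p) up        up x≢y′ y≢x′ with refl ← step-unique o p = refl
square-parallel (there o) (there p) down      down x≢y′ y≢x′ with refl ← step-unique o p = refl
square-parallel (there o) up        (there q) up x≢y′ y≢x′ = contradiction refl y≢x′
square-parallel (there o) down      (there q) down x≢y′ y≢x′ = contradiction refl y≢x′
square-parallel (there o) (there p) (there q) (there r) x≢y′ y≢x′
  with refl ← square-parallel o p q r (x≢y′ ∘ cong (_ ∷_)) (y≢x′ ∘ cong (_ ∷_)) = refl

-- Boxes

infix 4 _∈ᵇ_

-- Boxes are syntax rather than sets of points, so that they can be classified by recursion and
-- counted. The second index is the dimension, and `edge i` stands for the factor {i, i + 1}.
data Box : ℕ → ℕ → Set where
  []    : Box 0 0
  point : ℕ → Box n k → Box (suc n) k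
  edge  : ℕ → Box n k → Box (suc n) (suc k)

private variable
  B B′ : Box n k

data _∈ᵇ_ : Vec ℕ n → Box n k → Set where
  []    : [] ∈ᵇ []
  point : x ∈ᵇ B → i ∷ x ∈ᵇ point i B
  lower : x ∈ᵇ B → i ∷ x ∈ᵇ edge i B
  upper : x ∈ᵇ B → suc i ∷ x ∈ᵇ edge i B

corner : Box n k → Vec Bool k → Vec ℕ n
corner []          u           = []
corner (point i B) u           = i ∷ corner B u
corner (edge i B)  (false ∷ u) = i ∷ corner B u
corner (edge i B)  (true  ∷ u) = suc i ∷ corner B u

corner-∈ : ∀ (B : Box n k) u → corner B u ∈ᵇ B
corner-∈ []          []          = []
corner-∈ (point i B) u           = point (corner-∈ B u)
corner-∈ (edge i B)  (false ∷ u) = lower (corner-∈ B u)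
corner-∈ (edge i B)  (true  ∷ u) = upper (corner-∈ B u)

∈-corner : x ∈ᵇ B → ∃ λ u → corner B u ≡ x
∈-corner []        = [] , refl
∈-corner (point p) with u , refl ← ∈-corner p = u , refl
∈-corner (lower p) with u , refl ← ∈-corner p = false ∷ u , refl
∈-corner (upper p) with u , refl ← ∈-corner p = true  ∷ u , refl

∣n-1+n∣≡1 : ∀ n → ∣ n - suc n ∣ ≡ 1
∣n-1+n∣≡1 zero    = refl
∣n-1+n∣≡1 (suc n) = ∣n-1+n∣≡1 n

dist-corner : ∀ (B : Box n k) u v → dist (corner B u) (corner B v) ≡ hamming u v
dist-corner [] [] [] = refl
dist-corner (point i B) u v rewrite ℕ.∣n-n∣≡0 i = dist-corner B u v
dist-corner (edge i B) (false ∷ u) (false ∷ v) rewrite ℕ.∣n-n∣≡0 i = dist-corner B u v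
dist-corner (edge i B) (false ∷ u) (true  ∷ v) =
  cong₂ _+_ (∣n-1+n∣≡1 i) (dist-corner B u v)
dist-corner (edge i B) (true  ∷ u) (false ∷ v) =
  cong₂ _+_ (trans (ℕ.∣-∣-comm (suc i) i) (∣n-1+n∣≡1 i)) (dist-corner B u v)
dist-corner (edge i B) (true  ∷ u) (true  ∷ v) rewrite ℕ.∣n-n∣≡0 i = dist-corner B u v

corner-injective : ∀ (B : Box n k) {u v} → corner B u ≡ corner B v → u ≡ v
corner-injective []          {[]}        {[]}        eq = refl
corner-injective (point i B)                         eq = corner-injective B (Vec.∷-injectiveʳ eq)
corner-injective (edge i B)  {false ∷ _} {false ∷ _} eq =
  cong (false ∷_) (corner-injective B (Vec.∷-injectiveʳ eq))
corner-injective (edge i B)  {false ∷ _} {true  ∷ _} ()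
corner-injective (edge i B)  {true  ∷ _} {false ∷ _} ()
corner-injective (edge i B)  {true  ∷ _} {true  ∷ _} eq =
  cong (true ∷_) (corner-injective B (Vec.∷-injectiveʳ eq))

_⊆ᵇ_ : Box n k → Box n k → Set
B ⊆ᵇ B′ = ∀ {x} → x ∈ᵇ B → x ∈ᵇ B′

inhabited : (B : Box n k) → ∃ λ x → x ∈ᵇ B
inhabited B = corner B _ , corner-∈ B (replicate _ false)

point-tail : i ∷ x ∈ᵇ point i B → x ∈ᵇ B
point-tail (point p) = p

edge-tail : i ∷ x ∈ᵇ edge i B → x ∈ᵇ B
edge-tail (lower p) = p

-- A box is thus a canonical name for its set of points, so distinct boxes yield distinct cubes.
⊆ᵇ-antisym : (B B′ : Box n k) → B ⊆ᵇ B′ → B′ ⊆ᵇ B → B ≡ B′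
⊆ᵇ-antisym [] [] _ _ = refl
⊆ᵇ-antisym (point i B) (point i′ B′) sub sup
  with point _ ← sub (point (proj₂ (inhabited B)))
  = cong (point i) (⊆ᵇ-antisym B B′ (point-tail ∘ sub ∘ point) (point-tail ∘ sup ∘ point))
⊆ᵇ-antisym (edge i B) (edge i′ B′) sub sup
  -- One end alone could land on the other end of `edge i′`; asking for both ends at once forces `i`
  -- and `i′` to coincide.
  with sub (lower (proj₂ (inhabited B))) | sub (upper (proj₂ (inhabited B)))
... | lower _ | _ = cong (edge i) (⊆ᵇ-antisym B B′ (edge-tail ∘ sub ∘ lower) (edge-tail ∘ sup ∘ lower))
⊆ᵇ-antisym (point i B) (edge i′ B′) sub sup
  with sup (lower (proj₂ (inhabited B′))) | sup (upper (proj₂ (inhabited B′)))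
... | point _ | ()
⊆ᵇ-antisym (edge i B) (point i′ B′) sub sup
  with sub (lower (proj₂ (inhabited B))) | sub (upper (proj₂ (inhabited B)))
... | point _ | ()

-- Disjointness from the translate rules out an edge factor at coordinate `j`, since the two ends of
-- that edge would be a step inside `B`. The factor there is therefore a point, and turning it into
-- an edge adds exactly the translate.
thicken : ∀ (j : Fin n) (B : Box n k) →
          (∀ {x y} → Step (true , j) x y → x ∈ᵇ B → ¬ y ∈ᵇ B) →
          ∃ λ (B⁺ : Box n (suc k)) →
            ∀ z → z ∈ᵇ B⁺ ⇔ (z ∈ᵇ B ⊎ ∃ λ x → x ∈ᵇ B × Step (true , j) x z)
thicken zero (point i B) disjoint = edge i B , λ z → mk⇔
  (λ { (lower p) → inj₁ (point p) ; (upper p) → inj₂ (_ , point p , up) })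
  (λ { (inj₁ (point p)) → lower p ; (inj₂ (_ , point p , up)) → upper p })
thicken zero (edge i B) disjoint =
  contradiction (upper (proj₂ (inhabited B))) (disjoint up (lower (proj₂ (inhabited B))))
thicken (suc j) (point i B) disjoint =
  let B⁺ , eqv = thicken j B λ { s p q → disjoint (there s) (point p) (point q) }
  in point i B⁺ , λ z → mk⇔
    (λ { (point p) → Sum.map point (λ (_ , q , s) → _ , point q , there s) (to (eqv _) p) })
    (λ { (inj₁ (point p)) → point (from (eqv _) (inj₁ p))
       ; (inj₂ (_ , point p , there s)) → point (from (eqv _) (inj₂ (_ , p , s))) })
thicken (suc j) (edge i B) disjoint =
  let B⁺ , eqv = thicken j B λ { s p q → disjoint (there s) (lower p) (lower q) }
  in edge i B⁺ , λ z → mk⇔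
    (λ { (lower p) → Sum.map lower (λ (_ , q , s) → _ , lower q , there s) (to (eqv _) p)
       ; (upper p) → Sum.map upper (λ (_ , q , s) → _ , upper q , there s) (to (eqv _) p) })
    (λ { (inj₁ (lower p)) → lower (from (eqv _) (inj₁ p))
       ; (inj₁ (upper p)) → upper (from (eqv _) (inj₁ p))
       ; (inj₂ (_ , lower p , there s)) → lower (from (eqv _) (inj₂ (_ , p , s)))
       ; (inj₂ (_ , upper p , there s)) → upper (from (eqv _) (inj₂ (_ , p , s))) })

-- Hypercubes embedded in the grid

hamming-refl : (u : Vec Bool k) → hamming u u ≡ 0
hamming-refl []          = refl
hamming-refl (false ∷ u) = hamming-refl u
hamming-refl (true  ∷ u) = hamming-refl u

hamming-∷ : ∀ b (u v : Vec Bool k) → hamming (b ∷ u) (b ∷ v) ≡ hamming u v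
hamming-∷ false u v = refl
hamming-∷ true  u v = refl

-- Any two vertices are joined by a path that corrects one coordinate after another. It is applied
-- to the direction in which an embedded hypercube crosses from one facet to the other.
hypercube-connected : ∀ {A : Set} (g : Vec Bool k → A) →
  (∀ u v → hamming u v ≡ 1 → g u ≡ g v) → ∀ u v → g u ≡ g v
hypercube-connected g h [] [] = refl
hypercube-connected g h (b ∷ u) (b′ ∷ v) =
  trans (flip-head b b′) (hypercube-connected (g ∘ (b′ ∷_))
    (λ u v eq → h _ _ (trans (hamming-∷ b′ u v) eq)) u v)
  where
  flip-head : ∀ b b′ → g (b ∷ u) ≡ g (b′ ∷ u)
  flip-head false false = refl
  flip-head false true  = h _ _ (cong suc (hamming-refl u))
  flip-head true  false = h _ _ (cong suc (hamming-refl u))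
  flip-head true  true  = refl

Embedding : (Vec Bool k → Vec ℕ n) → Set
Embedding f = (∀ {u v} → f u ≡ f v → u ≡ v) × (∀ u v → hamming u v ≡ 1 → dist (f u) (f v) ≡ 1)

-- Induction on the dimension. The crossings between the facets `f₀` and `f₁` over adjacent vertices
-- are opposite sides of a 4-cycle, hence parallel, and by connectedness all crossings share one
-- direction. The image is the box of one facet thickened in that direction.
image-box : ∀ (f : Vec Bool k → Vec ℕ n) → Embedding f →
            ∃ λ (B : Box n k) → ∀ x → x ∈ᵇ B ⇔ ∃ λ u → f u ≡ x
image-box {zero} f _ = pointBox (f []) , λ x → mk⇔ (λ p → [] , ∈→ p) (λ { ([] , refl) → ∈pointBox _ })
  where
  pointBox : Vec ℕ n → Box n 0
  pointBox []      = []
  pointBox (i ∷ x) = point i (pointBox x)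

  ∈pointBox : (x : Vec ℕ n) → x ∈ᵇ pointBox x
  ∈pointBox []      = []
  ∈pointBox (i ∷ x) = point (∈pointBox x)

  ∈→ : x ∈ᵇ pointBox y → y ≡ x
  ∈→ {y = []} [] = refl
  ∈→ {y = i ∷ y} (point p) = cong (i ∷_) (∈→ p)
image-box {suc k} {n} f (inj , adj) = join (proj₁ direction₀) refl
  where
  f₀ f₁ : Vec Bool k → Vec ℕ n
  f₀ u = f (false ∷ u)
  f₁ u = f (true ∷ u)

  crossing : ∀ u → ∃ λ d → Step d (f₀ u) (f₁ u)
  crossing u = dist≡1⇒step _ _ (adj _ _ (cong suc (hamming-refl u)))

  direction₀ = crossing (replicate k false)

  parallel : ∀ u → Step (proj₁ direction₀) (f₀ u) (f₁ u)
  parallel u = subst (λ d → Step d (f₀ u) (f₁ u))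
    (hypercube-connected (proj₁ ∘ crossing) (λ u v uv → square-parallel
       (proj₂ (crossing u)) (proj₂ (crossing v))
       (proj₂ (dist≡1⇒step _ _ (adj (false ∷ u) (false ∷ v) uv)))
       (proj₂ (dist≡1⇒step _ _ (adj (true ∷ u) (true ∷ v) uv)))
       -- Each diagonal of the square joins points of opposite facets, so injectivity keeps its ends
       -- distinct.
       (λ eq → contradiction (inj eq) λ ()) (λ eq → contradiction (inj eq) λ ()))
     u (replicate k false))
    (proj₂ (crossing u))

  facet : ∀ b → Embedding (f ∘ (b ∷_))
  facet b = (λ eq → Vec.∷-injectiveʳ (inj eq)) ,
            λ u v uv → adj (b ∷ u) (b ∷ v) (trans (hamming-∷ b u v) uv)

  across : ∀ {b j} → (∀ u → Step (true , j) (f (b ∷ u)) (f (not b ∷ u))) →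
           ∀ {x y} u → f (b ∷ u) ≡ x → Step (true , j) x y → y ≡ f (not b ∷ u)
  across step u refl s = step-functional s (step u)

  glue : ∀ b {j} → (∀ u → Step (true , j) (f (b ∷ u)) (f (not b ∷ u))) →
         ∃ λ (B : Box n (suc k)) → ∀ x → x ∈ᵇ B ⇔ ∃ λ u → f u ≡ x
  glue b {j} step with B , eqv ← image-box (f ∘ (b ∷_)) (facet b)
    -- A step with both ends in the image of facet `b` would have an upper end that also comes from
    -- facet `not b`, and injectivity would equate `b` with `not b`.
    with B⁺ , eqv⁺ ← thicken j B (λ {x} {y} s p q →
           let u , fu≡x = to (eqv x) p
               v , fv≡y = to (eqv y) q
           in not-¬ refl (Vec.∷-injectiveˡ (inj (trans fv≡y (across step u fu≡x s)))))
    = B⁺ , λ z → mk⇔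
        (λ p → case to (eqv⁺ z) p of λ where
          (inj₁ q) → let u , eq = to (eqv z) q in b ∷ u , eq
          (inj₂ (x , q , s)) → let u , fu≡x = to (eqv x) q in
            not b ∷ u , sym (across step u fu≡x s))
        (λ (u , eq) → from (eqv⁺ z) (split z u eq))
    where
    split : ∀ z u → f u ≡ z → z ∈ᵇ B ⊎ ∃ λ x → x ∈ᵇ B × Step (true , j) x z
    split z (b′ ∷ u) refl with b′ ≟ᵇ b
    ... | yes refl = inj₁ (from (eqv z) (u , refl))
    ... | no b′≢b rewrite ¬-not b′≢b = inj₂ (_ , from (eqv _) (u , refl) , step u)

  -- Thickening only goes upwards, so the base is whichever facet has the smaller coordinate in the
  -- common direction.
  join : ∀ d → proj₁ direction₀ ≡ d → ∃ λ (B : Box n (suc k)) → ∀ x → x ∈ᵇ B ⇔ ∃ λ u → f u ≡ x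
  join (true  , j) eq = glue false λ u → subst (λ d → Step d _ _) eq (parallel u)
  join (false , j) eq = glue true  λ u → step-reverse (subst (λ d → Step d _ _) eq (parallel u))

-- Finite types and subsets

⊎-finite : {A B : Set} → Finite A → Finite B → Finite (A ⊎ B)
⊎-finite finA finB = record
  { card = card finA + card finB
  ; enum = ↔-sym Fin.+↔⊎ ↔-∘ (Finite.enum finA ⊎-↔ Finite.enum finB)
  }

card-cong : {A B : Set} (finA : Finite A) (finB : Finite B) → A ↔ B → card finA ≡ card finB
card-cong finA finB A↔B =
  Fin.↔⇒≡ (Finite.enum finB ↔-∘ (A↔B ↔-∘ ↔-sym (Finite.enum finA)))

does-true : {P : Set} (P? : Dec P) → does P? ≡ true → P
does-true (yes p) _ = p

subset : {P : Fin n → Set} → Decidable P → Subset n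
subset P? = tabulate (does ∘ P?)

∈-subset : {P : Fin n → Set} (P? : Decidable P) → ∀ i → i ∈ subset P? ⇔ P i
∈-subset P? i = mk⇔
  (λ i∈ → does-true (P? i) (trans (sym (Vec.lookup∘tabulate _ i)) (Vec.[]=⇒lookup i∈)))
  (λ p → Vec.lookup⇒[]= i _ (trans (Vec.lookup∘tabulate _ i) (dec-true (P? i) p)))

_∈ᵇ?_ : (x : Vec ℕ n) (B : Box n k) → Dec (x ∈ᵇ B)
x ∈ᵇ? B = map′ (λ { (u , refl) → corner-∈ B u }) ∈-corner
  (Finite.any? (Vec-finite Bool-finite _) (λ u → Vec.≡-dec ℕ._≟_ (corner B u) x))

-- Horadam cubes

module Horadam (a′ b : ℕ) where

  -- With `a` as a successor, `a′` is the number a - 1 of edges between letters below `a`.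
  a : ℕ
  a = suc a′

  -- Admissible strings, parsed uniquely into low letters and blocks of a 0 followed by a high
  -- letter. Peeling off the first piece leaves an admissible string, which admissibility stated by
  -- positions does not make visible.
  data Word : Vec ℕ n → Set where
    []   : Word []
    low  : i < a → Word x → Word (i ∷ x)
    high : a ≤ i → i < a + b → Word x → Word (0 ∷ i ∷ x)

  head<a : Word (i ∷ x) → i < a
  head<a (low i<a _)  = i<a
  head<a (high _ _ _) = s≤s z≤n

  tail-after-suc : Word (suc i ∷ x) → Word x
  tail-after-suc (low _ w) = w

  tail-before-low : i < a → Word (0 ∷ i ∷ x) → Word (i ∷ x)
  tail-before-low i<a (low _ w)      = w
  tail-before-low i<a (high a≤i _ _) = contradiction i<a (ℕ.≤⇒≯ a≤i)

  after-high : a ≤ i → Word (0 ∷ i ∷ x) → i < a + b × Word x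
  after-high a≤i (low _ w)        = contradiction (head<a w) (ℕ.≤⇒≯ a≤i)
  after-high a≤i (high _ i<a+b w) = i<a+b , w

  -- Both sizes of letter are covered for the sake of `edge₀`, whose lower end is the low letter
  -- `a′` when its index is 0.
  0∷-word : i < a + b → Word x → Word (0 ∷ i ∷ x)
  0∷-word {i} i<a+b w with ℕ.<-≤-connex i a
  ... | inj₁ i<a = low (s≤s z≤n) (low i<a w)
  ... | inj₂ a≤i = high a≤i i<a+b w

  -- Admissibility without the condition on the first letter, hence inherited by suffixes.
  Interior : Vec (Fin (a + b)) n → Set
  Interior x = ∀ i → 0 < toℕ i → a ≤ toℕ (lookup x i) →
    ∃ λ j → toℕ i ≡ suc (toℕ j) × toℕ (lookup x j) ≡ 0

  interior-tail : ∀ {l} {x : Vec (Fin (a + b)) n} → Interior (l ∷ x) → Interior x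
  interior-tail int i 0<i a≤ with int (suc i) (s≤s z≤n) a≤
  ... | zero  , eq , _  = contradiction (subst (0 <_) (ℕ.suc-injective eq) 0<i) λ ()
  ... | suc j , eq , l≡0 = j , ℕ.suc-injective eq , l≡0

  interior⇒word : (x : Vec (Fin (a + b)) n) → Interior x →
                  (∀ i → toℕ i ≡ 0 → toℕ (lookup x i) < a) → Word (Vec.map toℕ x)
  interior⇒word []      int first = []
  interior⇒word (l ∷ []) int first = low (first zero refl) []
  interior⇒word (l ∷ m ∷ x) int first with ℕ.<-≤-connex (toℕ m) a | interior⇒word (m ∷ x)
  ... | inj₁ m<a | rec = low (first zero refl)
          (rec (interior-tail {x = m ∷ x} int) λ { zero _ → m<a })
  ... | inj₂ a≤m | _ with int (suc zero) (s≤s z≤n) a≤m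
  ...   | suc _ , () , _
  ...   | zero , _ , l≡0 rewrite l≡0 = high a≤m (Fin.toℕ<n m)
          (interior⇒word x (interior-tail {x = x} (interior-tail {x = m ∷ x} int)) first′)
    where
    first′ : ∀ i → toℕ i ≡ 0 → toℕ (lookup x i) < a
    first′ zero refl with ℕ.<-≤-connex (toℕ (lookup x zero)) a
    ... | inj₁ <a = <a
    ... | inj₂ a≤ with int (suc (suc zero)) (s≤s z≤n) a≤
    -- A high letter is positive because `a` is, so no further high letter can follow it.
    ...   | suc zero , _ , m≡0 = contradiction (subst (a ≤_) m≡0 a≤m) λ ()

  admissible⇒word : (x : Vec (Fin (a + b)) n) → Admissible a b x → Word (Vec.map toℕ x)
  admissible⇒word x adm = interior⇒word x (λ i _ → adm i) first
    where
    first : ∀ i → toℕ i ≡ 0 → toℕ (lookup x i) < a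
    first i i≡0 with ℕ.<-≤-connex (toℕ (lookup x i)) a
    ... | inj₁ <a = <a
    ... | inj₂ a≤ with () ← trans (sym i≡0) (proj₁ (proj₂ (adm i a≤)))

  word⇒admissible : Word y → ∃ λ x → Vec.map toℕ x ≡ y × Admissible a b x
  word⇒admissible [] = [] , refl , λ ()
  word⇒admissible (low i<a w) with x , refl , adm ← word⇒admissible w =
    let i<a+b = ℕ.<-≤-trans i<a (ℕ.m≤m+n a b) in
    fromℕ< i<a+b ∷ x , cong (_∷ _) (Fin.toℕ-fromℕ< i<a+b) , λ where
      zero    a≤i → contradiction i<a (ℕ.≤⇒≯ (subst (a ≤_) (Fin.toℕ-fromℕ< i<a+b) a≤i))
      (suc p) a≤  → let j , eq , z = adm p a≤ in suc j , cong suc eq , z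
  word⇒admissible (high a≤i i<a+b w) with x , refl , adm ← word⇒admissible w =
    zero ∷ fromℕ< i<a+b ∷ x , cong (λ l → 0 ∷ l ∷ _) (Fin.toℕ-fromℕ< i<a+b) , λ where
      (suc zero)    _  → zero , refl , refl
      (suc (suc p)) a≤ → let j , eq , z = adm p a≤ in suc (suc j) , cong 2+ eq , z

  word : 𝓢 a b n → Vec ℕ n
  word v = Vec.map toℕ (value v)

  word-isWord : (v : 𝓢 a b n) → Word (word v)
  word-isWord (x Refinement., [ adm ]) = admissible⇒word x (recompute (admissible? a b x) adm)

  map-toℕ-injective : ∀ {m} (x y : Vec (Fin m) n) → Vec.map toℕ x ≡ Vec.map toℕ y → x ≡ y
  map-toℕ-injective []      []      eq = refl
  map-toℕ-injective (i ∷ x) (j ∷ y) eq = cong₂ _∷_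
    (Fin.toℕ-injective (Vec.∷-injectiveˡ eq)) (map-toℕ-injective x y (Vec.∷-injectiveʳ eq))

  word-injective : {v w : 𝓢 a b n} → word v ≡ word w → v ≡ w
  word-injective eq = value-injective (map-toℕ-injective _ _ eq)

  word-surjective : Word x → ∃ λ (v : 𝓢 a b n) → word v ≡ x
  word-surjective w = let x , eq , adm = word⇒admissible w in (x Refinement., [ adm ]) , eq

  distance≡dist : ∀ {m} (x y : Vec (Fin m) n) → distance x y ≡ dist (Vec.map toℕ x) (Vec.map toℕ y)
  distance≡dist []      []      = refl
  distance≡dist (i ∷ x) (j ∷ y) = cong₂ _+_ refl (distance≡dist x y)

  -- Boxes consisting of admissible words

  data HoradamBox : ℕ → ℕ → Set where
    []     : HoradamBox 0 0
    point  : Fin a  → HoradamBox n k → HoradamBox (suc n) k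
    edge   : Fin a′ → HoradamBox n k → HoradamBox (suc n) (suc k)
    point₀ : Fin b  → HoradamBox n k → HoradamBox (suc (suc n)) k
    edge₀  : Fin b  → HoradamBox n k → HoradamBox (suc (suc n)) (suc k)

  box : HoradamBox n k → Box n k
  box []           = []
  box (point i H)  = point (toℕ i) (box H)
  box (edge i H)   = edge (toℕ i) (box H)
  box (point₀ j H) = point 0 (point (a + toℕ j) (box H))
  -- The offset `a′` makes the upper end `a + toℕ j` range over the `b` high letters; for `j` zero
  -- the edge joins the low letter `a′` to the high letter `a`.
  box (edge₀ j H)  = point 0 (edge (a′ + toℕ j) (box H))

  box-words : (H : HoradamBox n k) → x ∈ᵇ box H → Word x
  box-words []           []                = []
  box-words (point i H)  (point p)         = low (Fin.toℕ<n i) (box-words H p)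
  box-words (edge i H)   (lower p)         = low (ℕ.m<n⇒m<1+n (Fin.toℕ<n i)) (box-words H p)
  box-words (edge i H)   (upper p)         = low (s≤s (Fin.toℕ<n i)) (box-words H p)
  box-words (point₀ j H) (point (point p)) = 0∷-word (ℕ.+-monoʳ-< a (Fin.toℕ<n j)) (box-words H p)
  box-words (edge₀ j H)  (point (lower p)) =
    0∷-word (ℕ.m<n⇒m<1+n (ℕ.+-monoʳ-< a′ (Fin.toℕ<n j))) (box-words H p)
  box-words (edge₀ j H)  (point (upper p)) =
    0∷-word (s≤s (ℕ.+-monoʳ-< a′ (Fin.toℕ<n j))) (box-words H p)

  split-letter : ∀ {l} m → m ≤ l → l < m + b → ∃ λ (j : Fin b) → m + toℕ j ≡ l
  split-letter {l} m m≤l l<m+b = fromℕ< l∸m<b ,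
    trans (cong (λ j → m + j) (Fin.toℕ-fromℕ< l∸m<b)) (ℕ.m+[n∸m]≡n m≤l)
    where
    l∸m<b : l ∸ m < b
    l∸m<b = ℕ.+-cancelˡ-< m _ _ (subst (_< m + b) (sym (ℕ.m+[n∸m]≡n m≤l)) l<m+b)

  -- A positive first letter cannot open a block, so after a positive point, or an edge (seen from
  -- its upper end), the tail is again a box of words. After the point 0 the largest letter of the
  -- second factor decides: if it is low, the tail is a box of words; if it is high, the first two
  -- factors form `point₀` or `edge₀`.
  box-surjective : (B : Box n k) → (∀ {x} → x ∈ᵇ B → Word x) → ∃ λ H → box H ≡ B
  box-surjective [] words = [] , refl
  box-surjective (edge i B) words
    with _ , p ← inhabited B
    with H , refl ← box-surjective B (tail-after-suc ∘ words ∘ upper)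
    = edge (fromℕ< i<a′) H , cong (λ i → edge i (box H)) (Fin.toℕ-fromℕ< i<a′)
    where
    i<a′ = ℕ.≤-pred (head<a (words (upper p)))
  box-surjective (point (suc i) B) words
    with _ , p ← inhabited B
    with H , refl ← box-surjective B (tail-after-suc ∘ words ∘ point)
    = point (fromℕ< i<a) H , cong (λ i → point i (box H)) (Fin.toℕ-fromℕ< i<a)
    where
    i<a = head<a (words (point p))
  box-surjective (point 0 []) words = point zero [] , refl
  box-surjective (point 0 (point l B)) words with ℕ.<-≤-connex l a | box-surjective (point l B)
  ... | inj₁ l<a | rec
    with H , eq ← rec (λ { (point p) → tail-before-low l<a (words (point (point p))) })
    = point zero H , cong (point 0) eq
  ... | inj₂ a≤l | _
    with _ , p ← inhabited B
    with j , refl ← split-letter a a≤l (proj₁ (after-high a≤l (words (point (point p)))))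
    with H , refl ← box-surjective B (λ p → proj₂ (after-high a≤l (words (point (point p)))))
    = point₀ j H , refl
  box-surjective (point 0 (edge l B)) words with ℕ.<-≤-connex (suc l) a | box-surjective (edge l B)
  ... | inj₁ 1+l<a | rec
    with H , eq ← rec (λ where
           (lower p) → tail-before-low (ℕ.<-trans (ℕ.n<1+n l) 1+l<a) (words (point (lower p)))
           (upper p) → tail-before-low 1+l<a (words (point (upper p))))
    = point zero H , cong (point 0) eq
  ... | inj₂ a≤1+l | _
    with _ , p ← inhabited B
    with j , refl ← split-letter a′ (ℕ.≤-pred a≤1+l)
                      (ℕ.≤-pred (proj₁ (after-high a≤1+l (words (point (upper p))))))
    with H , refl ← box-surjective B (λ p → proj₂ (after-high a≤1+l (words (point (upper p)))))
    = edge₀ j H , refl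

  point-injective : ∀ {i j} {B B′ : Box n k} → point i B ≡ point j B′ → i ≡ j × B ≡ B′
  point-injective refl = refl , refl

  edge-injective : ∀ {i j} {B B′ : Box n k} → edge i B ≡ edge j B′ → i ≡ j × B ≡ B′
  edge-injective refl = refl , refl

  -- Every word starts with a low letter. This separates `point zero` from `point₀`, which both
  -- begin with the point 0.
  box≢high-point : ∀ (H : HoradamBox (suc n) k) {j} {B : Box n k} → box H ≢ point (a + j) B
  box≢high-point H {j} {B} eq = ℕ.m+n≮m a j
    (head<a (box-words H (subst (a + j ∷ proj₁ (inhabited B) ∈ᵇ_) (sym eq) (point (proj₂ (inhabited B))))))

  -- The contradiction comes from the upper end `a + j`, since the lower end `a′ + j` is low when
  -- `j` is 0.
  box≢high-edge : ∀ (H : HoradamBox (suc n) (suc k)) {j} {B : Box n k} → box H ≢ edge (a′ + j) B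
  box≢high-edge H {j} {B} eq = ℕ.m+n≮m a j
    (head<a (box-words H (subst (a + j ∷ proj₁ (inhabited B) ∈ᵇ_) (sym eq) (upper (proj₂ (inhabited B))))))

  box-injective : (H H′ : HoradamBox n k) → box H ≡ box H′ → H ≡ H′
  box-injective [] [] eq = refl
  box-injective (point i H) (point i′ H′) eq with i≡i′ , eq′ ← point-injective eq =
    cong₂ point (Fin.toℕ-injective i≡i′) (box-injective H H′ eq′)
  box-injective (edge i H) (edge i′ H′) eq with i≡i′ , eq′ ← edge-injective eq =
    cong₂ edge (Fin.toℕ-injective i≡i′) (box-injective H H′ eq′)
  box-injective (point₀ j H) (point₀ j′ H′) eq
    with j≡j′ , eq′ ← point-injective (proj₂ (point-injective eq)) =
    cong₂ point₀ (Fin.toℕ-injective (ℕ.+-cancelˡ-≡ a _ _ j≡j′)) (box-injective H H′ eq′)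
  box-injective (edge₀ j H) (edge₀ j′ H′) eq
    with j≡j′ , eq′ ← edge-injective (proj₂ (point-injective eq)) =
    cong₂ edge₀ (Fin.toℕ-injective (ℕ.+-cancelˡ-≡ a′ _ _ j≡j′)) (box-injective H H′ eq′)
  box-injective (point i H) (point₀ j H′) eq =
    contradiction (proj₂ (point-injective eq)) (box≢high-point H)
  box-injective (point i H) (edge₀ j H′) eq =
    contradiction (proj₂ (point-injective eq)) (box≢high-edge H)
  box-injective (point₀ j H) (point i H′) eq =
    contradiction (proj₂ (point-injective (sym eq))) (box≢high-point H′)
  box-injective (edge₀ j H) (point i H′) eq =
    contradiction (proj₂ (point-injective (sym eq))) (box≢high-edge H′)

  -- Each case lists just the constructors that its indices allow, with `a`, `a′`, `b` and `b`
  -- choices of letter. From length 2 on, `card` therefore unfolds to the coefficientwise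
  -- recurrence, which later holds by `refl`.
  HoradamBox-finite : ∀ n k → Finite (HoradamBox n k)
  HoradamBox-finite 0 0 = record
    { card = 1
    ; enum = mk↔ₛ′ (λ _ → zero) (λ _ → []) (λ { zero → refl }) (λ { [] → refl })
    }
  HoradamBox-finite 0 (suc k) = record
    { card = 0
    ; enum = mk↔ₛ′ (λ ()) (λ ()) (λ ()) (λ ())
    }
  HoradamBox-finite 1 0 = finite-via
    (mk↔ₛ′ (λ { (point i H) → i , H }) (λ (i , H) → point i H) (λ _ → refl) (λ { (point _ _) → refl }))
    (×-finite (Fin-finite a) (HoradamBox-finite 0 0))
  HoradamBox-finite 1 (suc k) = finite-via
    (mk↔ₛ′ (λ { (point i H) → inj₁ (i , H) ; (edge i H) → inj₂ (i , H) })
           (λ { (inj₁ (i , H)) → point i H ; (inj₂ (i , H)) → edge i H })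
           (λ { (inj₁ _) → refl ; (inj₂ _) → refl })
           (λ { (point _ _) → refl ; (edge _ _) → refl }))
    (⊎-finite (×-finite (Fin-finite a) (HoradamBox-finite 0 (suc k)))
              (×-finite (Fin-finite a′) (HoradamBox-finite 0 k)))
  HoradamBox-finite (suc (suc n)) 0 = finite-via
    (mk↔ₛ′ (λ { (point i H) → inj₁ (i , H) ; (point₀ j H) → inj₂ (j , H) })
           (λ { (inj₁ (i , H)) → point i H ; (inj₂ (j , H)) → point₀ j H })
           (λ { (inj₁ _) → refl ; (inj₂ _) → refl })
           (λ { (point _ _) → refl ; (point₀ _ _) → refl }))
    (⊎-finite (×-finite (Fin-finite a) (HoradamBox-finite (suc n) 0))
              (×-finite (Fin-finite b) (HoradamBox-finite n 0)))
  HoradamBox-finite (suc (suc n)) (suc k) = finite-via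
    (mk↔ₛ′ (λ { (point i H)  → inj₁ (inj₁ (i , H)) ; (edge i H)  → inj₁ (inj₂ (i , H))
              ; (point₀ j H) → inj₂ (inj₁ (j , H)) ; (edge₀ j H) → inj₂ (inj₂ (j , H)) })
           (λ { (inj₁ (inj₁ (i , H))) → point i H  ; (inj₁ (inj₂ (i , H))) → edge i H
              ; (inj₂ (inj₁ (j , H))) → point₀ j H ; (inj₂ (inj₂ (j , H))) → edge₀ j H })
           (λ { (inj₁ (inj₁ _)) → refl ; (inj₁ (inj₂ _)) → refl
              ; (inj₂ (inj₁ _)) → refl ; (inj₂ (inj₂ _)) → refl })
           (λ { (point _ _) → refl ; (edge _ _) → refl ; (point₀ _ _) → refl ; (edge₀ _ _) → refl }))
    (⊎-finite (⊎-finite (×-finite (Fin-finite a) (HoradamBox-finite (suc n) (suc k)))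
                        (×-finite (Fin-finite a′) (HoradamBox-finite (suc n) k)))
              (⊎-finite (×-finite (Fin-finite b) (HoradamBox-finite n (suc k)))
                        (×-finite (Fin-finite b) (HoradamBox-finite n k))))

  -- Π a b n is kept abstract as a labelled graph: with Π a b n itself in place of G,
  -- conversion checking unfolds its enumeration of vertices and becomes intractable.
  module LabelledByWords (G : Graph) {n : ℕ} (label : Graph.Vertex G → Vec ℕ n)
    (label-injective : ∀ {u v} → label u ≡ label v → u ≡ v)
    (label-isWord : ∀ v → Word (label v))
    (label-surjective : ∀ {x} → Word x → ∃ λ v → label v ≡ x)
    (~⇔dist≡1 : ∀ u v → Graph._~_ G u v ⇔ dist (label u) (label v) ≡ 1)
    {k : ℕ}
    where

    open Graph G using (Vertex; finite; order)
    open Finite finite using (index; element; index-element; element-index)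

    infix 4 _carves_

    -- A relation, because subsets consist of vertex indices while boxes consist of grid points.
    _carves_ : Box n k → Subset order → Set
    B carves S = ∀ v → index v ∈ S ⇔ label v ∈ᵇ B

    carves-functional : ∀ B {S S′} → B carves S → B carves S′ → S ≡ S′
    carves-functional B c c′ = ⊆-antisym (sub c c′) (sub c′ c)
      where
      sub : ∀ {S S′} → B carves S → B carves S′ → ∀ {i} → i ∈ S → i ∈ S′
      sub {S} {S′} c c′ {i} i∈S = subst (_∈ S′) (index-element i)
        (from (c′ (element i)) (to (c (element i)) (subst (_∈ S) (sym (index-element i)) i∈S)))

    -- All points of `box H` are words and hence labels of vertices, so `S` accounts for the whole
    -- box.
    carves-injective : ∀ (H H′ : HoradamBox n k) {S} → box H carves S → box H′ carves S → H ≡ H′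
    carves-injective H H′ {S} c c′ =
      box-injective H H′ (⊆ᵇ-antisym _ _ (sub H H′ c c′) (sub H′ H c′ c))
      where
      sub : ∀ (H H′ : HoradamBox n k) → box H carves S → box H′ carves S → box H ⊆ᵇ box H′
      sub H H′ c c′ p with v , refl ← label-surjective (box-words H p) = to (c′ v) (from (c v) p)

    vertices : Box n k → Subset order
    vertices B = subset (λ i → label (element i) ∈ᵇ? B)

    vertices-carved : ∀ B → B carves vertices B
    vertices-carved B v = subst (λ w → index v ∈ vertices B ⇔ label w ∈ᵇ B) (element-index v)
      (∈-subset (λ i → label (element i) ∈ᵇ? B) (index v))

    -- `corner` maps the hypercube isometrically onto the box, and adjacency means distance 1 on
    -- both sides.
    carved⇒cube : ∀ {S} (H : HoradamBox n k) → box H carves S → induced G S ≅ Q k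
    carved⇒cube {S} H c = record
      { bijection = mk↔ₛ′ coords vertex coords-vertex vertex-coords
      ; adjacency = λ u v → mk⇔
          (λ uv → trans (isometry u v) (to (~⇔dist≡1 _ _) uv))
          (λ uv → from (~⇔dist≡1 _ _) (trans (sym (isometry u v)) uv))
      }
      where
      module I = Graph (induced G S)

      locate : (v : I.Vertex) → ∃ λ u → corner (box H) u ≡ label (value v)
      locate (v Refinement., [ p ]) = ∈-corner (to (c v) (recompute (index v ∈? S) p))

      coords : I.Vertex → Vec Bool k
      coords = proj₁ ∘ locate

      place : ∀ u → ∃ λ (v : Vertex) → label v ≡ corner (box H) u
      place u = label-surjective (box-words H (corner-∈ (box H) u))

      vertex : Vec Bool k → I.Vertex
      vertex u = proj₁ (place u) Refinement.,
        [ from (c (proj₁ (place u))) (subst (_∈ᵇ box H) (sym (proj₂ (place u))) (corner-∈ (box H) u)) ]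

      coords-vertex : ∀ u → coords (vertex u) ≡ u
      coords-vertex u = corner-injective (box H)
        (trans (proj₂ (locate (vertex u))) (proj₂ (place u)))

      vertex-coords : ∀ v → vertex (coords v) ≡ v
      vertex-coords v = value-injective (label-injective
        (trans (proj₂ (place (coords v))) (proj₂ (locate v))))

      isometry : ∀ u v → hamming (coords u) (coords v) ≡ dist (label (value u)) (label (value v))
      isometry u v = trans (sym (dist-corner (box H) (coords u) (coords v)))
        (cong₂ dist (proj₂ (locate u)) (proj₂ (locate v)))

    -- The inverse isomorphism followed by `label` embeds the hypercube in the grid. Its image is a
    -- box by `image-box`, and the points of that box are labels, hence words, so `box-surjective`
    -- applies.
    cube⇒carved : ∀ {S} → induced G S ≅ Q k → ∃ λ (H : HoradamBox n k) → box H carves S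
    cube⇒carved {S} iso = carver
      where
      open _≅_ iso
      module φ = Inverse bijection

      f : Vec Bool k → Vec ℕ n
      f u = label (value (φ.from u))

      embedding : Embedding f
      embedding =
        (λ eq → Injection.injective (Inverse⇒Injection (↔-sym bijection))
                  (value-injective (label-injective eq))) ,
        λ u v uv → to (~⇔dist≡1 _ _) (from (adjacency _ _) (subst₂ (λ u v → hamming u v ≡ 1)
          (sym (φ.strictlyInverseˡ u)) (sym (φ.strictlyInverseˡ v)) uv))

      preimage : ∀ v u → f u ≡ label v → index v ∈ S
      preimage v u eq with refl ← label-injective {value (φ.from u)} {v} eq
        with [ v∈S ] ← proof (φ.from u) = recompute (index v ∈? S) v∈S

      carver : ∃ λ (H : HoradamBox n k) → box H carves S
      carver with B , image ← image-box f embedding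
        with H , refl ← box-surjective B (λ {x} p → let u , eq = to (image x) p in
                          subst Word eq (label-isWord (value (φ.from u))))
        = H , λ v → mk⇔
            (λ v∈S → from (image _)
              (φ.to (v Refinement., [ v∈S ]) , cong (label ∘ value) (φ.strictlyInverseʳ _)))
            (λ p → let u , eq = to (image _) p in preimage v u eq)

    -- The round trips rest on uniqueness: a box carves only one subset, and a subset is carved by
    -- at most one `HoradamBox`.
    HoradamBox↔cube : HoradamBox n k ↔ [ S ∈ Subset order ∣ induced G S ≅ Q k ]
    HoradamBox↔cube = mk↔ₛ′
      cube
      (proj₁ ∘ carving)
      (λ T → let H , c = carving T in
        value-injective (carves-functional (box H) (vertices-carved (box H)) c))
      (λ H → let H′ , c = carving (cube H) in
        carves-injective H′ H c (vertices-carved (box H)))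
      where
      cube : HoradamBox n k → [ S ∈ Subset order ∣ induced G S ≅ Q k ]
      cube H = vertices (box H) Refinement., [ carved⇒cube H (vertices-carved (box H)) ]

      carving : (T : [ S ∈ Subset order ∣ induced G S ≅ Q k ]) →
                ∃ λ (H : HoradamBox n k) → box H carves value T
      carving (S Refinement., [ iso ]) = cube⇒carved (recompute (induced G S ≅? Q k) iso)

    coeff-C-labelled : coeff (C G) k ≡ + card (HoradamBox-finite n k)
    coeff-C-labelled = trans (coeff-C G k)
      (cong +_ (sym (card-cong (HoradamBox-finite n k) (cubes G k) HoradamBox↔cube)))

  ~⇔dist≡1 : ∀ {n} (u v : 𝓢 a b n) → Graph._~_ (Π a b n) u v ⇔ dist (word u) (word v) ≡ 1
  ~⇔dist≡1 u v = mk⇔ (trans (sym eq)) (trans eq)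
    where
    eq : distance (value u) (value v) ≡ dist (word u) (word v)
    eq = distance≡dist (value u) (value v)

  count : ℕ → ℕ → ℕ
  count n k = card (HoradamBox-finite n k)

  -- a is spelled out as suc a′ so that the type matches its uses without unfolding Π.
  coeff-C-Π : ∀ n k → coeff (C (Π (suc a′) b n)) k ≡ + count n k
  coeff-C-Π n k = coeff-C-labelled
    where
    open LabelledByWords (Π (suc a′) b n) {n} word
      word-injective word-isWord word-surjective ~⇔dist≡1 {k}

-- Polynomials

coeff-+ₚ : ∀ p q k → coeff (p +ₚ q) k ≡ coeff p k ℤ.+ coeff q k
coeff-+ₚ []      q       k       = sym (ℤ.+-identityˡ _)
coeff-+ₚ (x ∷ p) []      k       = sym (ℤ.+-identityʳ _)
coeff-+ₚ (x ∷ p) (y ∷ q) zero    = refl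
coeff-+ₚ (x ∷ p) (y ∷ q) (suc k) = coeff-+ₚ p q k

coeff-map : ∀ x p k → coeff (List.map (x ℤ.*_) p) k ≡ x ℤ.* coeff p k
coeff-map x []      k       = sym (ℤ.*-zeroʳ x)
coeff-map x (y ∷ p) zero    = refl
coeff-map x (y ∷ p) (suc k) = coeff-map x p k

-- The left side is what the constant coefficient of `const x +ₚ const y *ₚ X` computes to; its
-- linear coefficient computes to y * 1.
linear-constant : ∀ x y → x ℤ.+ (y ℤ.* 0ℤ ℤ.+ 0ℤ) ≡ x
linear-constant = solve-∀

coeff-linear-zero : ∀ x y p → coeff ((const x +ₚ const y *ₚ X) *ₚ p) 0 ≡ x ℤ.* coeff p 0
coeff-linear-zero x y p
  rewrite linear-constant x y
  = trans (coeff-+ₚ (List.map (x ℤ.*_) p) _ 0) (trans (ℤ.+-identityʳ _) (coeff-map x p 0))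

coeff-linear-suc : ∀ x y p k →
  coeff ((const x +ₚ const y *ₚ X) *ₚ p) (suc k) ≡ x ℤ.* coeff p (suc k) ℤ.+ y ℤ.* coeff p k
coeff-linear-suc x y p k
  rewrite linear-constant x y | ℤ.*-identityʳ y
  = trans (coeff-+ₚ (List.map (x ℤ.*_) p) _ (suc k)) (cong₂ ℤ._+_ (coeff-map x p (suc k))
      -- Multiplication by the last coefficient `y` leaves a summand `const 0ℤ`, the shift of the
      -- empty product.
      (trans (coeff-+ₚ (List.map (y ℤ.*_) p) (const 0ℤ) k)
        (trans (cong₂ ℤ._+_ (coeff-map y p k) (coeff-const0 k)) (ℤ.+-identityʳ _))))
  where
  coeff-const0 : ∀ k → coeff (const 0ℤ) k ≡ 0ℤ
  coeff-const0 zero    = refl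
  coeff-const0 (suc k) = refl

-- This carries the recurrence for box counts over to polynomials by comparing coefficients: degree
-- 0 sees only `α` and `β`, while in degree `suc k` the terms with `α′` and `β′` enter shifted by
-- one.
linear-recurrence : ∀ α α′ β β′ p q r {f g h : ℕ → ℕ} →
  (∀ k → coeff p k ≡ + f k) → (∀ k → coeff q k ≡ + g k) → (∀ k → coeff r k ≡ + h k) →
  f 0 ≡ α * g 0 + β * h 0 →
  (∀ k → f (suc k) ≡ (α * g (suc k) + α′ * g k) + (β * h (suc k) + β′ * h k)) →
  p ≋ (const (+ α) +ₚ const (+ α′) *ₚ X) *ₚ q +ₚ (const (+ β) +ₚ const (+ β′) *ₚ X) *ₚ r
linear-recurrence α α′ β β′ p q r {f} {g} {h} p≗f q≗g r≗h f₀ f₊ = λ where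
    zero → begin
      coeff p 0
        ≡⟨ trans (p≗f 0) (cong +_ f₀) ⟩
      + (α * g 0 + β * h 0)
        ≡⟨ pos-+* α (g 0) β (h 0) ⟩
      + α ℤ.* + g 0 ℤ.+ + β ℤ.* + h 0
        ≡⟨ cong₂ (λ x y → + α ℤ.* x ℤ.+ + β ℤ.* y) (q≗g 0) (r≗h 0) ⟨
      + α ℤ.* coeff q 0 ℤ.+ + β ℤ.* coeff r 0
        ≡⟨ cong₂ ℤ._+_ (coeff-linear-zero (+ α) (+ α′) q) (coeff-linear-zero (+ β) (+ β′) r) ⟨
      coeff Lq 0 ℤ.+ coeff Lr 0
        ≡⟨ coeff-+ₚ Lq Lr 0 ⟨
      coeff (Lq +ₚ Lr) 0 ∎
    (suc k) → begin
      coeff p (suc k)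
        ≡⟨ trans (p≗f (suc k)) (cong +_ (f₊ k)) ⟩
      + ((α * g (suc k) + α′ * g k) + (β * h (suc k) + β′ * h k))
        ≡⟨ cong₂ ℤ._+_ (pos-+* α (g (suc k)) α′ (g k)) (pos-+* β (h (suc k)) β′ (h k)) ⟩
      (+ α ℤ.* + g (suc k) ℤ.+ + α′ ℤ.* + g k) ℤ.+ (+ β ℤ.* + h (suc k) ℤ.+ + β′ ℤ.* + h k)
        ≡⟨ cong₂ ℤ._+_
             (cong₂ (λ x y → + α ℤ.* x ℤ.+ + α′ ℤ.* y) (q≗g (suc k)) (q≗g k))
             (cong₂ (λ x y → + β ℤ.* x ℤ.+ + β′ ℤ.* y) (r≗h (suc k)) (r≗h k)) ⟨
      (+ α ℤ.* coeff q (suc k) ℤ.+ + α′ ℤ.* coeff q k) ℤ.+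
      (+ β ℤ.* coeff r (suc k) ℤ.+ + β′ ℤ.* coeff r k)
        ≡⟨ cong₂ ℤ._+_ (coeff-linear-suc (+ α) (+ α′) q k) (coeff-linear-suc (+ β) (+ β′) r k) ⟨
      coeff Lq (suc k) ℤ.+ coeff Lr (suc k)
        ≡⟨ coeff-+ₚ Lq Lr (suc k) ⟨
      coeff (Lq +ₚ Lr) (suc k) ∎
  where
  open ≡-Reasoning

  Lq Lr : Poly
  Lq = (const (+ α) +ₚ const (+ α′) *ₚ X) *ₚ q
  Lr = (const (+ β) +ₚ const (+ β′) *ₚ X) *ₚ r

  pos-+* : ∀ m n o p → + (m * n + o * p) ≡ + m ℤ.* + n ℤ.+ + o ℤ.* + p
  pos-+* m n o p = cong₂ ℤ._+_ (ℤ.pos-* m n) (ℤ.pos-* o p)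

-- The recurrence and the initial conditions

corollary2 : ∀ (a b : ℕ) → 1 ≤ a → 1 ≤ b →
    (∀ n → 2 ≤ n →
    C (Π a b n) ≋ (const (+ a) +ₚ const (+ a - + 1) *ₚ X) *ₚ C (Π a b (n ∸ 1))
    +ₚ (const (+ b) +ₚ const (+ b) *ₚ X) *ₚ C (Π a b (n ∸ 2)))
    × C (Π a b 0) ≋ const (+ 1)
    × C (Π a b 1) ≋ const (+ a) +ₚ const (+ a - + 1) *ₚ X
corollary2 (suc a′) b _ _ = recurrence , initial₀ , initial₁
  where
  open Horadam a′ b using (coeff-C-Π)

  -- The coefficient `+ suc a′ - + 1` computes to `+ a′`.
  recurrence : ∀ n → 2 ≤ n →
    C (Π (suc a′) b n) ≋ (const (+ suc a′) +ₚ const (+ a′) *ₚ X) *ₚ C (Π (suc a′) b (n ∸ 1))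
                  +ₚ (const (+ b) +ₚ const (+ b) *ₚ X) *ₚ C (Π (suc a′) b (n ∸ 2))
  recurrence (suc zero) (s≤s ())
  recurrence (2+ n) _ = linear-recurrence (suc a′) a′ b b
    (C (Π (suc a′) b (2+ n))) (C (Π (suc a′) b (suc n))) (C (Π (suc a′) b n))
    (coeff-C-Π (2+ n)) (coeff-C-Π (suc n)) (coeff-C-Π n) refl (λ _ → refl)

  initial₀ : C (Π (suc a′) b 0) ≋ const (+ 1)
  initial₀ zero    = coeff-C-Π 0 0
  initial₀ (suc k) = coeff-C-Π 0 (suc k)

  initial₁ : C (Π (suc a′) b 1) ≋ const (+ suc a′) +ₚ const (+ a′) *ₚ X
  -- At length 1 the counts are a * 1, a * 0 + a′ * 1 and a * 0 + a′ * 0 in degrees 0, 1 and above.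
  initial₁ zero          = trans (coeff-C-Π 1 0)
    (trans (cong +_ (ℕ.*-identityʳ (suc a′))) (sym (linear-constant (+ suc a′) (+ a′))))
  initial₁ (suc zero)    = trans (coeff-C-Π 1 1)
    (trans (cong (λ m → + (m + a′ * 1)) (ℕ.*-zeroʳ (suc a′))) (ℤ.pos-* a′ 1))
  initial₁ (suc (suc k)) = trans (coeff-C-Π 1 (2+ k))
    (cong₂ (λ m m′ → + (m + m′)) (ℕ.*-zeroʳ (suc a′)) (ℕ.*-zeroʳ a′))
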